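{- Let $k$ be an integer with $k \ge 2$, and let $G$ be a disconnected graph. Then $G$ is a cograph minimal $(k,\infty)$-polar obstruction if and only if $G$ is a cograph minimal polar obstruction (i.e., a cograph minimal $(\infty,\infty)$-polar obstruction). Equivalently, a graph $G$ is a connected cograph minimal $(\infty,k)$-polar obstruction if and only if $G$ is a connected cograph minimal polar obstruction.
   Context: All graphs are finite and simple. A cograph is a graph with no induced subgraph isomorphic to the path $P_4$. A cluster is a graph that is a disjoint union of complete graphs. For $s,k \in \mathbb{Z}_{\ge 0}\cup\{\infty\}$, an $(s,k)$-polar partition of a graph $G$ is a partition $(A,B)$ of $V(G)$ (parts may be empty) such that $G[A]$ is a complete multipartite graph with at most $s$ parts and $G[B]$ is a cluster with at most $k$ components; the value $\infty$ means the corresponding number is unbounded. $G$ is $(s,k)$-polar if it admits an $(s,k)$-polar partition, and polar if it is $(\infty,\infty)$-polar. A cograph minimal $(s,k)$-polar obstruction is a cograph that is not $(s,k)$-polar but all of whose proper induced subgraphs are $(s,k)$-polar; a cograph minimal polar obstruction is a cograph minimal $(\infty,\infty)$-polar obstruction. -}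

module Defs where

open import Data.Nat using (ℕ; zero; suc; _<_)
open import Data.Fin using (Fin; zero; suc)
open import Data.Bool using (Bool; true; false)
open import Data.Unit using (⊤)
open import Data.Empty using (⊥)
open import Data.Product using (Σ; ∃; _×_; _,_)
open import Function.Definitions using (Injective)
open import Relation.Binary.PropositionalEquality using (_≡_; _≢_; cong)
open import Relation.Nullary using (¬_)

record Graph : Set where
  field
    n      : ℕ
    adj    : Fin n → Fin n → Bool
    sym    : ∀ u v → adj u v ≡ adj v u
    irrefl : ∀ u → adj u u ≡ false
open Graph public

Adj : (G : Graph) → Fin (n G) → Fin (n G) → Set
Adj G u v = adj G u v ≡ true

-- Induced subgraph of G on the image of an injective map f : Fin m → Fin (n G).
induced : (G : Graph) {m : ℕ} (f : Fin m → Fin (n G)) → Graph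
induced G {m} f = record
  { n = m
  ; adj = λ i j → adj G (f i) (f j)
  ; sym = λ i j → sym G (f i) (f j)
  ; irrefl = λ i → irrefl G (f i)
  }

record InducedEmbedding (H G : Graph) : Set where
  field
    emb      : Fin (n H) → Fin (n G)
    emb-inj  : Injective _≡_ _≡_ emb
    emb-adj  : ∀ i j → adj G (emb i) (emb j) ≡ adj H i j

p4adj : Fin 4 → Fin 4 → Bool
p4adj zero (suc zero) = true
p4adj (suc zero) zero = true
p4adj (suc zero) (suc (suc zero)) = true
p4adj (suc (suc zero)) (suc zero) = true
p4adj (suc (suc zero)) (suc (suc (suc zero))) = true
p4adj (suc (suc (suc zero))) (suc (suc zero)) = true
p4adj _ _ = false

P4 : Graph
P4 = record { n = 4 ; adj = p4adj ; sym = s ; irrefl = i }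
  where
  s : ∀ u v → p4adj u v ≡ p4adj v u
  s zero zero = _≡_.refl
  s zero (suc zero) = _≡_.refl
  s zero (suc (suc zero)) = _≡_.refl
  s zero (suc (suc (suc zero))) = _≡_.refl
  s (suc zero) zero = _≡_.refl
  s (suc zero) (suc zero) = _≡_.refl
  s (suc zero) (suc (suc zero)) = _≡_.refl
  s (suc zero) (suc (suc (suc zero))) = _≡_.refl
  s (suc (suc zero)) zero = _≡_.refl
  s (suc (suc zero)) (suc zero) = _≡_.refl
  s (suc (suc zero)) (suc (suc zero)) = _≡_.refl
  s (suc (suc zero)) (suc (suc (suc zero))) = _≡_.refl
  s (suc (suc (suc zero))) zero = _≡_.refl
  s (suc (suc (suc zero))) (suc zero) = _≡_.refl
  s (suc (suc (suc zero))) (suc (suc zero)) = _≡_.refl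
  s (suc (suc (suc zero))) (suc (suc (suc zero))) = _≡_.refl
  i : ∀ u → p4adj u u ≡ false
  i zero = _≡_.refl
  i (suc zero) = _≡_.refl
  i (suc (suc zero)) = _≡_.refl
  i (suc (suc (suc zero))) = _≡_.refl

Cograph : Graph → Set
Cograph G = ¬ InducedEmbedding P4 G

data Reachable (G : Graph) : Fin (n G) → Fin (n G) → Set where
  here : ∀ {u} → Reachable G u u
  step : ∀ {u v w} → Adj G u v → Reachable G v w → Reachable G u w

Connected : Graph → Set
Connected G = ∀ u v → Reachable G u v

Disconnected : Graph → Set
Disconnected G = ¬ Connected G

data ℕ∞ : Set where
  fin : ℕ → ℕ∞
  ∞   : ℕ∞

-- Index x is an allowed part / component label under bound s
-- (labels 0,…,s-1 when s is finite, any label when s = ∞).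
Below : ℕ∞ → ℕ → Set
Below (fin s) x = x < s
Below ∞ x = ⊤

-- (s,k)-polar partition: inA u = true means u ∈ A, otherwise u ∈ B.
-- G[A] is complete multipartite with at most s parts: there is a labelling
-- of A by at most s part-labels such that two distinct vertices of A are
-- adjacent iff they lie in different parts.
-- G[B] is a cluster with at most k components: there is a labelling of B
-- by at most k labels such that two distinct vertices of B are adjacent
-- iff they have the same label.
record PolarPartition (s k : ℕ∞) (G : Graph) : Set where
  field
    inA      : Fin (n G) → Bool
    part     : Fin (n G) → ℕ
    comp     : Fin (n G) → ℕ
    part-ok  : ∀ u → inA u ≡ true → Below s (part u)
    comp-ok  : ∀ u → inA u ≡ false → Below k (comp u)
    multi⇒   : ∀ u v → inA u ≡ true → inA v ≡ true → u ≢ v →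
               Adj G u v → part u ≢ part v
    multi⇐   : ∀ u v → inA u ≡ true → inA v ≡ true → u ≢ v →
               part u ≢ part v → Adj G u v
    clus⇒    : ∀ u v → inA u ≡ false → inA v ≡ false → u ≢ v →
               Adj G u v → comp u ≡ comp v
    clus⇐    : ∀ u v → inA u ≡ false → inA v ≡ false → u ≢ v →
               comp u ≡ comp v → Adj G u v

IsPolar : ℕ∞ → ℕ∞ → Graph → Set
IsPolar s k G = PolarPartition s k G

-- Proper induced subgraphs: induced subgraphs on m < n vertices
-- (given by injective maps Fin m → Fin n).
CographMinimalObstruction : ℕ∞ → ℕ∞ → Graph → Set
CographMinimalObstruction s k G =
  Cograph G ×
  ¬ IsPolar s k G ×
  (∀ {m} (f : Fin m → Fin (n G)) → Injective _≡_ _≡_ f → m < n G →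
     IsPolar s k (induced G f))

{-# OPTIONS --safe #-}

-- Fix a separation of G. A complete multipartite G[A] with an edge is connected, hence lies on
-- one side, and then the other side is a cluster; but a minimal obstruction has no cluster side,
-- since that side could be added to B in a partition of the rest. So a polar partition of a
-- minimal (k,∞)-obstruction has A independent, which is absurd.
--
-- Conversely, reading off its cotree, a cograph is (1,∞)-polar or contains one of K₁⊕C₄, K₂⊕2K₂,
-- K₁⊕(P₃+K₂) and (K₁+K₂)⊕(K₁+K₂). If G is a minimal polar obstruction then one side contains such
-- a graph O and the other side, not being a cluster, contains P₃. As P₃+O is not polar, G = P₃+O,
-- and all vertex-deleted subgraphs of P₃+O are even (2,∞)-polar.
module Submission where

open import Defs
open import Data.Bool using (Bool; true; false; not; _∧_; _xor_; if_then_else_)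
import Data.Bool.Properties as Bool
open import Data.Bool.ListAction using (any)
open import Data.Empty using (⊥)
open import Data.Fin using (Fin; zero; suc; toℕ; splitAt; join; punchIn; punchOut; #_)
open import Data.Fin.Properties using (_≟_; all?; any?; ¬∀⟶∃¬; injective⇒≤; join-splitAt; punchIn-injective; punchIn-punchOut)
open import Data.Fin.Subset using (Subset; _∈_; _⊂_; _∩_; Nonempty) renaming (⊤ to full)
open import Data.Fin.Subset.Induction using (Acc; acc; ⊂-wellFounded)
open import Data.Fin.Subset.Properties using (_∈?_; nonempty?; anySubset?; x∈p∩q⁺; x∈p∩q⁻; ∈⊤)
open import Data.List using (List; []; _∷_)
open import Data.List.Relation.Unary.Any as Any using (Any)
open import Data.Nat as ℕ using (ℕ; zero; suc; _+_; _≡ᵇ_; _≤_; _<_; z≤n; s≤s)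
import Data.Nat.Properties as ℕ
open import Data.Product using (Σ; ∃; _×_; _,_; proj₁; proj₂)
open import Data.Sum using (_⊎_; inj₁; inj₂; [_,_]′; swap)
open import Data.Unit using (tt) renaming (⊤ to Unit)
open import Data.Vec using ([]; _∷_; lookup; tabulate)
open import Data.Vec.Properties using (lookup∘tabulate; lookup⇒[]=; []=⇒lookup)
open import Function using (_∘_; id)
open import Function.Definitions using (Injective)
open import Level using (0ℓ)
open import Relation.Binary.PropositionalEquality using (_≡_; _≢_; refl; trans; cong; cong₂; subst) renaming (sym to ≡-sym)
open import Relation.Nullary using (¬_; Dec; does; yes; no; ¬?; contradiction)
open import Relation.Nullary.Decidable using (_×-dec_; _⊎-dec_; _→-dec_; dec-true; dec-false; decidable-stable; toWitness)
open import Relation.Unary using (Pred; Decidable)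

private
  variable
    s     : ℕ∞
    G H K : Graph

Whole : {A : Set} → Pred A 0ℓ
Whole _ = Unit

true≢false : ∀ {b} → b ≡ true → b ≢ false
true≢false refl ()

≢true⇒false : ∀ {b} → b ≢ true → b ≡ false
≢true⇒false = Bool.¬-not

-- Relative polarity

module _ (G : Graph) where

  -- Disjoint unions of complete graphs are the graphs without an induced P₃; this form avoids
  -- component labels and is decidable for decidable `P`.
  Cluster : Pred (Fin (n G)) 0ℓ → Set
  Cluster P = ∀ u → P u → ∀ v → P v → adj G u v ≡ true →
              ∀ w → P w → adj G v w ≡ true → u ≢ w → adj G u w ≡ true

  -- The label-free form: the parts are the classes of non-adjacency.
  CompleteMultipartite : Pred (Fin (n G)) 0ℓ → Set
  CompleteMultipartite P = ∀ u → P u → ∀ v → P v → adj G u v ≡ false →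
                           ∀ w → P w → adj G v w ≡ false → adj G u w ≡ false

  Homogeneous : Bool → Pred (Fin (n G)) 0ℓ → Set
  Homogeneous β P = ∀ {u v} → P u → P v → u ≢ v → adj G u v ≡ β

  -- Polarity of the subgraph induced on `P`, phrased on the vertices of `G` itself so that passing
  -- to a subgraph involves no renumbering.
  record PolarOn (s : ℕ∞) (P : Pred (Fin (n G)) 0ℓ) : Set where
    field
      inA     : Fin (n G) → Bool
      part    : Fin (n G) → ℕ
      part-ok : ∀ {u} → P u → inA u ≡ true → Below s (part u)
      multi⇒  : ∀ {u v} → P u → P v → inA u ≡ true → inA v ≡ true →
                adj G u v ≡ true → part u ≢ part v
      multi⇐  : ∀ {u v} → P u → P v → inA u ≡ true → inA v ≡ true →
                part u ≢ part v → adj G u v ≡ true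
      cluster : Cluster (λ u → P u × inA u ≡ false)

    part-≡ : ∀ {u v} → P u → P v → inA u ≡ true → inA v ≡ true →
             adj G u v ≡ false → part u ≡ part v
    part-≡ {u} {v} Pu Pv Au Av e = decidable-stable (part u ℕ.≟ part v) λ ne →
      true≢false (multi⇐ Pu Pv Au Av ne) e

adj⇒≢ : ∀ G {u v} → adj G u v ≡ true → u ≢ v
adj⇒≢ G e refl = true≢false e (irrefl G _)

-- Since `h` is constrained on `Q` alone, this covers inclusions and also their partial inverses,
-- which take an arbitrary value elsewhere.
pullback : ∀ {P Q} (h : Fin (n H) → Fin (n G)) →
           (∀ {i} → Q i → P (h i)) →
           (∀ {i j} → Q i → Q j → h i ≡ h j → i ≡ j) →
           (∀ {i j} → Q i → Q j → adj G (h i) (h j) ≡ adj H i j) →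
           PolarOn G s P → PolarOn H s Q
pullback h h-in h-inj h-adj π = record
  { inA     = π.inA ∘ h
  ; part    = π.part ∘ h
  ; part-ok = π.part-ok ∘ h-in
  ; multi⇒  = λ Qu Qv Au Av e → π.multi⇒ (h-in Qu) (h-in Qv) Au Av (trans (h-adj Qu Qv) e)
  ; multi⇐  = λ Qu Qv Au Av ne →
      trans (≡-sym (h-adj Qu Qv)) (π.multi⇐ (h-in Qu) (h-in Qv) Au Av ne)
  ; cluster = λ u (Qu , Bu) v (Qv , Bv) uv w (Qw , Bw) vw u≢w →
      trans (≡-sym (h-adj Qu Qw))
        (π.cluster (h u) (h-in Qu , Bu)
                   (h v) (h-in Qv , Bv) (trans (h-adj Qu Qv) uv)
                   (h w) (h-in Qw , Bw) (trans (h-adj Qv Qw) vw)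
                   (u≢w ∘ h-inj Qu Qw))
  }
  where module π = PolarOn π

first : ∀ {m} → (Fin m → Bool) → ℕ
first {zero}  p = 0
first {suc m} p = if p zero then 0 else suc (first (p ∘ suc))

first-cong : ∀ {m} {p q : Fin m → Bool} → (∀ i → p i ≡ q i) → first p ≡ first q
first-cong {zero}  eq = refl
first-cong {suc m} eq =
  cong₂ (λ b r → if b then 0 else suc r) (eq zero) (first-cong (eq ∘ suc))

-- The two witnesses rule out the value `m` that `first` takes on an everywhere false predicate, so
-- the common index satisfies both predicates.
first-meet : ∀ {m} (p q : Fin m → Bool) → first p ≡ first q →
             ∃ (λ i → p i ≡ true) → ∃ (λ i → q i ≡ true) →
             ∃ λ i → p i ≡ true × q i ≡ true
first-meet {suc m} p q eq (i , pi) (j , qj) with p zero in p0 | q zero in q0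
... | true  | true  = zero , p0 , q0
... | true  | false with () ← eq
... | false | true  with () ← eq
first-meet {suc m} p q eq (zero , pi)  (j , qj)     | false | false = contradiction p0 (true≢false pi)
first-meet {suc m} p q eq (suc i , pi) (zero , qj)  | false | false = contradiction q0 (true≢false qj)
first-meet {suc m} p q eq (suc i , pi) (suc j , qj) | false | false
  with k , pk , qk ← first-meet (p ∘ suc) (q ∘ suc) (ℕ.suc-injective eq) (i , pi) (j , qj)
  = suc k , pk , qk

does-cong : ∀ {A B : Set} (a? : Dec A) (b? : Dec B) → (A → B) → (B → A) → does a? ≡ does b?
does-cong a? (yes b) f g = dec-true a? (g b)
does-cong a? (no ¬b) f g = dec-false a? (¬b ∘ f)

does⁻ : ∀ {A : Set} (a? : Dec A) → does a? ≡ true → A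
does⁻ (yes a) _ = a

-- A component of the cluster is labelled by its first vertex.
fromPolarOn : PolarOn G s Whole → IsPolar s ∞ G
fromPolarOn {G} {s} π = record
  { inA     = inA
  ; part    = part
  ; comp    = comp
  ; part-ok = λ u → part-ok _
  ; comp-ok = λ _ _ → _
  ; multi⇒  = λ u v Au Av _ → multi⇒ _ _ Au Av
  ; multi⇐  = λ u v Au Av _ → multi⇐ _ _ Au Av
  ; clus⇒   = λ u v Bu Bv u≢v e → first-cong λ w → does-cong (near? u w) (near? v w)
      (near-trans Bu Bv u≢v e) (near-trans Bv Bu (u≢v ∘ ≡-sym) (trans (sym G v u) e))
  ; clus⇐   = λ u v Bu Bv u≢v eq →
      let w , u-w , v-w = first-meet _ _ eq (u , near-refl Bu) (v , near-refl Bv)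
      in common Bu Bv u≢v (does⁻ (near? u w) u-w) (does⁻ (near? v w) v-w)
  }
  where
  open PolarOn π

  -- The closed neighbourhood of `u` within `B`; for `u` in `B` it is the component of `u`.
  Near : Fin (n G) → Fin (n G) → Set
  Near u w = inA w ≡ false × (u ≡ w ⊎ adj G u w ≡ true)

  near? : ∀ u w → Dec (Near u w)
  near? u w = (inA w Bool.≟ false) ×-dec ((u ≟ w) ⊎-dec (adj G u w Bool.≟ true))

  comp : Fin (n G) → ℕ
  comp u = first (λ w → does (near? u w))

  near-refl : ∀ {u} → inA u ≡ false → does (near? u u) ≡ true
  near-refl {u} Bu = dec-true (near? u u) (Bu , inj₁ refl)

  near-trans : ∀ {u v w} → inA u ≡ false → inA v ≡ false → u ≢ v → adj G u v ≡ true →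
               Near u w → Near v w
  near-trans {u} {v} Bu Bv u≢v uv (Bw , inj₁ refl) = Bw , inj₂ (trans (sym G v u) uv)
  near-trans {u} {v} {w} Bu Bv u≢v uv (Bw , inj₂ uw) with v ≟ w
  ... | yes v≡w = Bw , inj₁ v≡w
  ... | no  v≢w = Bw , inj₂ (cluster v (_ , Bv) u (_ , Bu) (trans (sym G v u) uv) w (_ , Bw) uw v≢w)

  common : ∀ {u v w} → inA u ≡ false → inA v ≡ false → u ≢ v → Near u w → Near v w →
           adj G u v ≡ true
  common Bu Bv u≢v (_ , inj₁ refl) (_ , inj₁ refl) = contradiction refl u≢v
  common {u} {v} Bu Bv u≢v (_ , inj₁ refl) (_ , inj₂ vw) = trans (sym G u v) vw
  common Bu Bv u≢v (_ , inj₂ uw) (_ , inj₁ refl) = uw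
  common {u} {v} {w} Bu Bv u≢v (Bw , inj₂ uw) (_ , inj₂ vw) =
    cluster u (_ , Bu) w (_ , Bw) uw v (_ , Bv) (trans (sym G w v) vw) u≢v

toPolarOn : IsPolar s ∞ G → PolarOn G s Whole
toPolarOn {G = G} π = record
  { inA     = inA
  ; part    = part
  ; part-ok = λ _ → part-ok _
  ; multi⇒  = λ _ _ Au Av e → multi⇒ _ _ Au Av (adj⇒≢ G e) e
  ; multi⇐  = λ _ _ Au Av ne → multi⇐ _ _ Au Av (ne ∘ cong part) ne
  ; cluster = λ u (_ , Bu) v (_ , Bv) uv w (_ , Bw) vw u≢w →
      clus⇐ u w Bu Bw u≢w (trans (clus⇒ u v Bu Bv (adj⇒≢ G uv) uv) (clus⇒ v w Bv Bw (adj⇒≢ G vw) vw))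
  }
  where open PolarPartition π

-- Proper induced subgraphs and vertex deletion

deletion : ∀ {N} (v : Fin N) → (∀ u → u ≡ v) ⊎
  ∃ λ m → Σ (Fin m → Fin N) λ f → Injective _≡_ _≡_ f × m < N ×
  Σ (Fin N → Fin m) λ h → ∀ {u} → u ≢ v → f (h u) ≡ u
-- A single vertex is a separate case: no map `Fin 1 → Fin 0` can serve as `h`.
deletion {suc zero}    zero = inj₁ λ { zero → refl }
deletion {suc (suc m)} v    = inj₂ (suc m , punchIn v , punchIn-injective v _ _ , ℕ.≤-refl , h , f∘h)
  where
  h : Fin (suc (suc m)) → Fin (suc m)
  h u with v ≟ u
  -- An arbitrary value at the deleted vertex.
  ... | yes _   = zero
  ... | no  v≢u = punchOut v≢u

  f∘h : ∀ {u} → u ≢ v → punchIn v (h u) ≡ u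
  f∘h {u} u≢v with v ≟ u
  ... | yes v≡u = contradiction (≡-sym v≡u) u≢v
  ... | no  v≢u = punchIn-punchOut v≢u

missed : ∀ {m N} (f : Fin m → Fin N) → m < N → ∃ λ v → ∀ i → f i ≢ v
missed {m} {N} f m<N =
  let v , ¬hit = ¬∀⟶∃¬ N (λ v → ∃ λ i → f i ≡ v) (λ v → any? λ i → f i ≟ v) not-onto
  in v , λ i eq → ¬hit (i , eq)
  where
  not-onto : ¬ (∀ v → ∃ λ i → f i ≡ v)
  -- If `f` were onto, a section of it would inject `Fin N` into `Fin m`.
  not-onto onto = ℕ.<⇒≱ m<N (injective⇒≤ {f = proj₁ ∘ onto} λ {u} {v} eq →
    trans (≡-sym (proj₂ (onto u))) (trans (cong f eq) (proj₂ (onto v))))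

ProperPolar : ℕ∞ → Graph → Set
ProperPolar s G = ∀ {m} (f : Fin m → Fin (n G)) → Injective _≡_ _≡_ f → m < n G →
                  IsPolar s ∞ (induced G f)

proper⇒deleted : ProperPolar s G → ∀ v → PolarOn G s (_≢ v)
proper⇒deleted proper v with deletion v
-- `v` is the only vertex, so all conditions are vacuous.
... | inj₁ only = record
  { inA     = λ _ → true
  ; part    = λ _ → 0
  ; part-ok = λ {u} u≢v → contradiction (only u) u≢v
  ; multi⇒  = λ {u} u≢v → contradiction (only u) u≢v
  ; multi⇐  = λ {u} u≢v → contradiction (only u) u≢v
  ; cluster = λ u (u≢v , _) → contradiction (only u) u≢v
  }
proper⇒deleted {G = G} proper v | inj₂ (m , f , f-inj , m<N , h , f∘h) =
  pullback h _
    (λ i≢v j≢v eq → trans (≡-sym (f∘h i≢v)) (trans (cong f eq) (f∘h j≢v)))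
    (λ i≢v j≢v → cong₂ (adj G) (f∘h i≢v) (f∘h j≢v))
    (toPolarOn (proper f f-inj m<N))

-- A proper induced subgraph misses some vertex `v`, hence embeds in the graph without `v`.
deleted⇒proper : (∀ v → PolarOn G s (_≢ v)) → ProperPolar s G
deleted⇒proper deleted f f-inj m<N =
  let v , miss = missed f m<N
  in fromPolarOn (pullback f (λ {i} _ → miss i) (λ _ _ → f-inj) (λ _ _ → refl) (deleted v))

-- Gluing graphs

cross : Bool → (H K : Graph) → Fin (n H) ⊎ Fin (n K) → Fin (n H) ⊎ Fin (n K) → Bool
cross β H K (inj₁ a) (inj₁ b) = adj H a b
cross β H K (inj₂ a) (inj₂ b) = adj K a b
cross β H K _        _        = β

glue : Bool → Graph → Graph → Graph
glue β H K = record
  { n      = n H + n K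
  ; adj    = λ i j → cross β H K (splitAt (n H) i) (splitAt (n H) j)
  ; sym    = λ i j → cross-sym (splitAt (n H) i) (splitAt (n H) j)
  ; irrefl = λ i → cross-irrefl (splitAt (n H) i)
  }
  where
  cross-sym : ∀ x y → cross β H K x y ≡ cross β H K y x
  cross-sym (inj₁ a) (inj₁ b) = sym H a b
  cross-sym (inj₁ _) (inj₂ _) = refl
  cross-sym (inj₂ _) (inj₁ _) = refl
  cross-sym (inj₂ a) (inj₂ b) = sym K a b

  cross-irrefl : ∀ x → cross β H K x x ≡ false
  cross-irrefl (inj₁ a) = irrefl H a
  cross-irrefl (inj₂ a) = irrefl K a

K₁ : Graph
K₁ = record { n = 1 ; adj = λ _ _ → false ; sym = λ _ _ → refl ; irrefl = λ _ → refl }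

pair : Bool → Graph
pair β = glue β K₁ K₁

-- cherry true = P₃, cherry false = K₁+K₂, quad true = C₄, quad false = 2K₂.
cherry : Bool → Graph
cherry β = glue β K₁ (pair (not β))

quad : Bool → Graph
quad β = glue β (pair (not β)) (pair (not β))

-- C₄, the butterfly K₁⊕2K₂, and P₃+K₂: the minimal cographs that are neither split nor a cluster.
coneBase : Fin 3 → Graph
coneBase zero             = quad true
coneBase (suc zero)       = glue true K₁ (quad false)
coneBase (suc (suc zero)) = glue false (cherry true) (pair true)

-- 0 ≅ 3 and 1 ≅ 4; the duplicates save regrouping the joins when an obstruction is found.
monoObstruction : Fin 6 → Graph
monoObstruction zero                               = glue true K₁ (coneBase (# 0))
monoObstruction (suc zero)                         = glue true K₁ (coneBase (# 1))
monoObstruction (suc (suc zero))                   = glue true K₁ (coneBase (# 2))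
monoObstruction (suc (suc (suc zero)))             = glue true (pair false) (cherry true)
monoObstruction (suc (suc (suc (suc zero))))       = glue true (pair true) (quad false)
monoObstruction (suc (suc (suc (suc (suc zero))))) = glue true (cherry false) (cherry false)

polarObstruction : Fin 6 → Graph
polarObstruction i = glue false (cherry true) (monoObstruction i)

-- Cotrees

record EmbedsIn (H : Graph) (G : Graph) (p : Subset (n G)) : Set where
  field
    emb     : Fin (n H) → Fin (n G)
    emb-∈   : ∀ i → emb i ∈ p
    emb-inj : ∀ {i j} → emb i ≡ emb j → i ≡ j
    emb-adj : ∀ i j → adj G (emb i) (emb j) ≡ adj H i j

select : ∀ {m} {Q : Pred (Fin m) 0ℓ} → Decidable Q → Subset m → Subset m
select Q? p = p ∩ tabulate (λ u → does (Q? u))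

module _ {m} {Q : Pred (Fin m) 0ℓ} (Q? : Decidable Q) {p : Subset m} where

  ∈-select⁺ : ∀ {u} → u ∈ p → Q u → u ∈ select Q? p
  ∈-select⁺ {u} u∈p Qu =
    x∈p∩q⁺ (u∈p , lookup⇒[]= u _ (trans (lookup∘tabulate _ u) (dec-true (Q? u) Qu)))

  ∈-select⁻ : ∀ {u} → u ∈ select Q? p → u ∈ p × Q u
  ∈-select⁻ {u} u∈ =
    let u∈p , u∈Q = x∈p∩q⁻ p _ u∈
    in u∈p , does⁻ (Q? u) (trans (≡-sym (lookup∘tabulate _ u)) ([]=⇒lookup u∈Q))

  select-⊂ : ∀ {u} → u ∈ p → ¬ Q u → select Q? p ⊂ p
  select-⊂ u∈p ¬Qu = proj₁ ∘ ∈-select⁻ , _ , u∈p , ¬Qu ∘ proj₂ ∘ ∈-select⁻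

-- Opaque, so that p, side, b and v can be inferred from membership proofs.
abstract

  cut : ∀ {m} → Subset m → (Fin m → Bool) → Bool → Subset m
  cut p side b = select (λ u → side u Bool.≟ b) p

  delete : ∀ {m} → Fin m → Subset m → Subset m
  delete v = select λ u → ¬? (u ≟ v)

  ∈-cut⁺ : ∀ {m} {p : Subset m} {side b u} → u ∈ p → side u ≡ b → u ∈ cut p side b
  ∈-cut⁺ {side = side} {b} = ∈-select⁺ λ u → side u Bool.≟ b

  ∈-cut⁻ : ∀ {m} {p : Subset m} {side b u} → u ∈ cut p side b → u ∈ p × side u ≡ b
  ∈-cut⁻ {side = side} {b} = ∈-select⁻ λ u → side u Bool.≟ b

  cut-⊂ : ∀ {m} {p : Subset m} {side b u} → u ∈ p → side u ≢ b → cut p side b ⊂ p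
  cut-⊂ {side = side} {b} = select-⊂ λ u → side u Bool.≟ b

  ∈-delete⁺ : ∀ {m} {p : Subset m} {v u} → u ∈ p → u ≢ v → u ∈ delete v p
  ∈-delete⁺ {v = v} = ∈-select⁺ λ u → ¬? (u ≟ v)

  ∈-delete⁻ : ∀ {m} {p : Subset m} {v u} → u ∈ delete v p → u ∈ p × u ≢ v
  ∈-delete⁻ {v = v} = ∈-select⁻ λ u → ¬? (u ≟ v)

  delete-⊂ : ∀ {m} {p : Subset m} {v} → v ∈ p → delete v p ⊂ p
  delete-⊂ {v = v} v∈p = select-⊂ (λ u → ¬? (u ≟ v)) v∈p λ v≢v → v≢v refl

Crosses : (G : Graph) → Bool → Subset (n G) → (Fin (n G) → Bool) → Set
Crosses G β p side = ∀ {u v} → u ∈ p → v ∈ p → side u ≢ side v → adj G u v ≡ β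

-- β = true is a join and β = false a disjoint union.
data Cotree (G : Graph) (p : Subset (n G)) : Set where
  leaf : ∀ v → v ∈ p → (∀ {u} → u ∈ p → u ≡ v) → Cotree G p
  node : ∀ β side → Crosses G β p side → (∀ b → Cotree G (cut p side b)) → Cotree G p

inhabited : ∀ {p} → Cotree G p → Nonempty p
inhabited (leaf v v∈p _)     = v , v∈p
inhabited (node _ _ _ child) = let v , v∈ = inhabited (child true) in v , proj₁ (∈-cut⁻ v∈)

-- Decomposing a cograph as a join or a disjoint union

record Bipartition (G : Graph) (p : Subset (n G)) : Set where
  field
    β       : Bool
    side    : Fin (n G) → Bool
    crosses : Crosses G β p side
    both    : ∀ b → ∃ λ u → u ∈ p × side u ≡ b

bipartition : ∀ {p} β {Q : Pred (Fin (n G)) 0ℓ} (Q? : Decidable Q) →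
              (∀ {u v} → u ∈ p → v ∈ p → Q u → ¬ Q v → adj G u v ≡ β) →
              (∃ λ u → u ∈ p × Q u) → (∃ λ u → u ∈ p × ¬ Q u) → Bipartition G p
bipartition {G} {p} β Q? across (x , x∈p , Qx) (y , y∈p , ¬Qy) = record
  { β       = β
  ; side    = does ∘ Q?
  ; crosses = crosses
  ; both    = λ { true → x , x∈p , dec-true (Q? x) Qx ; false → y , y∈p , dec-false (Q? y) ¬Qy }
  }
  where
  crosses : Crosses G β p (does ∘ Q?)
  crosses {u} {v} u∈p v∈p ne with Q? u | Q? v
  ... | yes _  | yes _  = contradiction refl ne
  ... | yes Qu | no ¬Qv = across u∈p v∈p Qu ¬Qv
  ... | no ¬Qu | yes Qv = trans (sym G u v) (across v∈p u∈p Qv ¬Qu)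
  ... | no _   | no _   = contradiction refl ne

-- Makes every adjacency-preserving map out of P₄ injective, since vertices with a common image have
-- the same neighbourhood.
P4-twin-free : ∀ i j → (∀ l → p4adj i l ≡ p4adj j l) → i ≡ j
P4-twin-free = toWitness {a? = all? λ i → all? λ j →
  all? (λ l → p4adj i l Bool.≟ p4adj j l) →-dec (i ≟ j)} _

module _ (cograph : Cograph G) where

  no-path : ∀ {a b c d} → adj G a b ≡ true → adj G b c ≡ true → adj G c d ≡ true →
            adj G a c ≡ false → adj G b d ≡ false → adj G a d ≡ false → ⊥
  no-path {a} {b} {c} {d} ab bc cd ac bd ad = cograph record
    { emb     = e
    ; emb-inj = λ {i} {j} eq → P4-twin-free i j λ l →
        trans (≡-sym (e-adj i l)) (trans (cong (λ x → adj G x (e l)) eq) (e-adj j l))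
    ; emb-adj = e-adj
    }
    where
    e : Fin 4 → Fin (n G)
    e = lookup (a ∷ b ∷ c ∷ d ∷ [])

    flip : ∀ {u v β} → adj G u v ≡ β → adj G v u ≡ β
    flip {u} {v} = trans (sym G v u)

    e-adj : ∀ i j → adj G (e i) (e j) ≡ p4adj i j
    e-adj zero zero = irrefl G a
    e-adj zero (suc zero) = ab
    e-adj zero (suc (suc zero)) = ac
    e-adj zero (suc (suc (suc zero))) = ad
    e-adj (suc zero) zero = flip ab
    e-adj (suc zero) (suc zero) = irrefl G b
    e-adj (suc zero) (suc (suc zero)) = bc
    e-adj (suc zero) (suc (suc (suc zero))) = bd
    e-adj (suc (suc zero)) zero = flip ac
    e-adj (suc (suc zero)) (suc zero) = flip bc
    e-adj (suc (suc zero)) (suc (suc zero)) = irrefl G c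
    e-adj (suc (suc zero)) (suc (suc (suc zero))) = cd
    e-adj (suc (suc (suc zero))) zero = flip ad
    e-adj (suc (suc (suc zero))) (suc zero) = flip bd
    e-adj (suc (suc (suc zero))) (suc (suc zero)) = flip cd
    e-adj (suc (suc (suc zero))) (suc (suc (suc zero))) = irrefl G d

  -- P₄ is self-complementary: the non-edges of a-b-c-d form the path c-a-d-b.
  no-alternating-path : ∀ β {a b c d} →
    adj G a b ≡ not β → adj G b c ≡ not β → adj G c d ≡ not β →
    adj G a c ≡ β → adj G b d ≡ β → adj G a d ≡ β → ⊥
  no-alternating-path false ab bc cd ac bd ad = no-path ab bc cd ac bd ad
  no-alternating-path true {a} {b} {c} {d} ab bc cd ac bd ad =
    no-path (trans (sym G c a) ac) ad (trans (sym G d b) bd) cd ab (trans (sym G c b) bc)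

  -- Suppose p − v splits with cross adjacency β and v has a β-neighbour x on side b and a
  -- non-β-neighbour y on the other side. Then the β-neighbours of v on side b split off p,
  -- because a non-β-pair c, d with c among them and d on side b but not would give the
  -- alternating path c-d-v-y.
  extend : ∀ {p v} → v ∈ p → Bipartition G (delete v p) → Bipartition G p
  extend {p} {v} v∈p old = extend′
    where
    open Bipartition old

    extend′ : Bipartition G p
    extend′ with any? (λ u → (u ∈? delete v p) ×-dec (adj G v u Bool.≟ β))
    -- `v` has no `β`-neighbour, so `v` alone splits off with cross adjacency `not β`.
    ... | no none = bipartition (not β) (_≟ v)
      (λ { _ w∈p refl w≢v → Bool.¬-not λ e → none (_ , ∈-delete⁺ w∈p w≢v , e) })
      (v , v∈p , refl)
      (let w , w∈ , _ = both true in w , ∈-delete⁻ w∈)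
    ... | yes (x , x∈ , vx)
      with any? (λ u → (u ∈? delete v p) ×-dec ¬? (side u Bool.≟ side x) ×-dec (adj G v u Bool.≟ not β))
    -- `v` is a `β`-neighbour of everything on the side opposite to `x`, so it joins the side of
    -- `x`.
    ... | no none = bipartition β (λ u → (u ≟ v) ⊎-dec (side u Bool.≟ side x))
      across
      (v , v∈p , inj₁ refl)
      (let w , w∈ , sw = both (not (side x)) in
       w , proj₁ (∈-delete⁻ w∈) ,
       λ { (inj₁ w≡v) → proj₂ (∈-delete⁻ w∈) w≡v ; (inj₂ sx) → Bool.not-¬ sx sw })
      where
      across : ∀ {u w} → u ∈ p → w ∈ p → u ≡ v ⊎ side u ≡ side x →
               ¬ (w ≡ v ⊎ side w ≡ side x) → adj G u w ≡ β
      across {u} {w} u∈p w∈p Qu ¬Qw with u ≟ v | Qu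
      ... | no u≢v   | inj₁ u≡v = contradiction u≡v u≢v
      ... | no u≢v   | inj₂ su  = crosses (∈-delete⁺ u∈p u≢v) (∈-delete⁺ w∈p (¬Qw ∘ inj₁))
                                    λ eq → ¬Qw (inj₂ (trans (≡-sym eq) su))
      ... | yes refl | _        = decidable-stable (adj G v w Bool.≟ β) λ ne →
        none (w , ∈-delete⁺ w∈p (¬Qw ∘ inj₁) , ¬Qw ∘ inj₂ , Bool.¬-not ne)
    ... | yes (y , y∈ , sy , vy) = bipartition β
      (λ u → ¬? (u ≟ v) ×-dec (side u Bool.≟ side x) ×-dec (adj G v u Bool.≟ β))
      across
      (x , proj₁ (∈-delete⁻ x∈) , proj₂ (∈-delete⁻ x∈) , refl , vx)
      (v , v∈p , λ (v≢v , _) → v≢v refl)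
      where
      across : ∀ {c d} → c ∈ p → d ∈ p → c ≢ v × side c ≡ side x × adj G v c ≡ β →
               ¬ (d ≢ v × side d ≡ side x × adj G v d ≡ β) → adj G c d ≡ β
      across {c} {d} c∈p d∈p (c≢v , sc , vc) ¬Qd with d ≟ v | side d Bool.≟ side x
      ... | yes refl | _      = trans (sym G c v) vc
      ... | no d≢v   | no sd  = crosses (∈-delete⁺ c∈p c≢v) (∈-delete⁺ d∈p d≢v) λ eq → sd (trans (≡-sym eq) sc)
      ... | no d≢v   | yes sd = decidable-stable (adj G c d Bool.≟ β) λ ne →
        no-alternating-path β
          (Bool.¬-not ne)
          (trans (sym G d v) (Bool.¬-not λ vd → ¬Qd (d≢v , sd , vd)))
          vy
          (trans (sym G c v) vc)
          (crosses (∈-delete⁺ d∈p d≢v) y∈ λ eq → sy (trans (≡-sym eq) sd))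
          (crosses (∈-delete⁺ c∈p c≢v) y∈ λ eq → sy (trans (≡-sym eq) sc))

  -- Seinsche's theorem: a cograph with at least two vertices is disconnected or has a disconnected
  -- complement. One vertex is removed, the rest is decomposed by induction, and the vertex is put
  -- back.
  decompose : ∀ p → Acc _⊂_ p → Nonempty p →
              (∃ λ v → v ∈ p × (∀ {u} → u ∈ p → u ≡ v)) ⊎ Bipartition G p
  decompose p (acc rec) (v , v∈p) with nonempty? (delete v p)
  ... | no empty = inj₁ (v , v∈p , λ {u} u∈p →
    decidable-stable (u ≟ v) λ u≢v → empty (u , ∈-delete⁺ u∈p u≢v))
  ... | yes ne with decompose (delete v p) (rec (delete-⊂ v∈p)) ne
  ... | inj₂ old = inj₂ (extend v∈p old)
  ... | inj₁ (w , w∈ , only) = inj₂ (bipartition (adj G v w) (_≟ v)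
    (λ { _ d∈p refl d≢v → cong (adj G v) (only (∈-delete⁺ d∈p d≢v)) })
    (v , v∈p , refl)
    (w , ∈-delete⁻ w∈))

  cotree : ∀ p → Acc _⊂_ p → Nonempty p → Cotree G p
  cotree p (acc rec) ne with decompose p (⊂-wellFounded p) ne
  ... | inj₁ (v , v∈p , only) = leaf v v∈p only
  ... | inj₂ old = node β side crosses λ b →
    let u , u∈p , su = both b
        w , w∈p , sw = both (not b)
    in cotree (cut p side b) (rec (cut-⊂ w∈p λ sw′ → Bool.not-¬ sw′ sw)) (u , ∈-cut⁺ u∈p su)
    where open Bipartition old

-- Monopolarity of cographs

∀-bool : ∀ {P : Bool → Set} → P true → P false → ∀ b → P b
∀-bool pt pf true  = pt
∀-bool pt pf false = pf

all-or-some : ∀ {P Q : Bool → Set} → (∀ b → P b ⊎ Q b) → (∀ b → P b) ⊎ ∃ Q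
all-or-some f with f true | f false
... | inj₁ pt | inj₁ pf = inj₁ (∀-bool pt pf)
... | inj₂ qt | _       = inj₂ (true , qt)
... | inj₁ _  | inj₂ qf = inj₂ (false , qf)

b≢not-b : ∀ b → b ≢ not b
b≢not-b b = Bool.not-¬ refl

not-b≢b : ∀ b → not b ≢ b
not-b≢b b = b≢not-b b ∘ ≡-sym

module _ (G : Graph) where

  embed-K₁ : ∀ {p} → Nonempty p → EmbedsIn K₁ G p
  embed-K₁ (v , v∈p) = record
    { emb     = λ _ → v
    ; emb-∈   = λ _ → v∈p
    ; emb-inj = λ { {zero} {zero} _ → refl }
    ; emb-adj = λ _ _ → irrefl G v
    }

  widen : ∀ {p side b} → EmbedsIn H G (cut p side b) → EmbedsIn H G p
  widen e = record { EmbedsIn e ; emb-∈ = proj₁ ∘ ∈-cut⁻ ∘ EmbedsIn.emb-∈ e }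

  embed-glue : ∀ {β p side b c} → Crosses G β p side → b ≢ c →
               EmbedsIn H G (cut p side b) → EmbedsIn K G (cut p side c) →
               EmbedsIn (glue β H K) G p
  embed-glue {H} {K} {β} {p} {side} crosses b≢c eH eK = record
    { emb     = e ∘ splitAt (n H)
    ; emb-∈   = e-∈ ∘ splitAt (n H)
    ; emb-inj = λ {i} {j} eq →
        trans (≡-sym (join-splitAt (n H) (n K) i))
          (trans (cong (join (n H) (n K)) (e-inj (splitAt (n H) i) (splitAt (n H) j) eq))
            (join-splitAt (n H) (n K) j))
    ; emb-adj = λ i j → e-adj (splitAt (n H) i) (splitAt (n H) j)
    }
    where
    module H = EmbedsIn eH
    module K = EmbedsIn eK

    e : Fin (n H) ⊎ Fin (n K) → Fin (n G)
    e = [ H.emb , K.emb ]′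

    e-∈ : ∀ x → e x ∈ p
    e-∈ (inj₁ a) = proj₁ (∈-cut⁻ (H.emb-∈ a))
    e-∈ (inj₂ a) = proj₁ (∈-cut⁻ (K.emb-∈ a))

    apart : ∀ a b → side (H.emb a) ≢ side (K.emb b)
    apart a b eq =
      b≢c (trans (≡-sym (proj₂ (∈-cut⁻ (H.emb-∈ a)))) (trans eq (proj₂ (∈-cut⁻ (K.emb-∈ b)))))

    e-inj : ∀ x y → e x ≡ e y → x ≡ y
    e-inj (inj₁ a) (inj₁ b) eq = cong inj₁ (H.emb-inj eq)
    e-inj (inj₁ a) (inj₂ b) eq = contradiction (cong side eq) (apart a b)
    e-inj (inj₂ a) (inj₁ b) eq = contradiction (cong side (≡-sym eq)) (apart b a)
    e-inj (inj₂ a) (inj₂ b) eq = cong inj₂ (K.emb-inj eq)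

    e-adj : ∀ x y → adj G (e x) (e y) ≡ cross β H K x y
    e-adj (inj₁ a) (inj₁ b) = H.emb-adj a b
    e-adj (inj₁ a) (inj₂ b) = crosses (e-∈ (inj₁ a)) (e-∈ (inj₂ b)) (apart a b)
    e-adj (inj₂ a) (inj₁ b) = crosses (e-∈ (inj₂ a)) (e-∈ (inj₁ b)) (apart b a ∘ ≡-sym)
    e-adj (inj₂ a) (inj₂ b) = K.emb-adj a b

  homogeneous⇒cluster : ∀ {β P} → Homogeneous G β P → Cluster G P
  homogeneous⇒cluster {β = true}  hom u Pu v Pv uv w Pw vw u≢w = hom Pu Pw u≢w
  homogeneous⇒cluster {β = false} hom u Pu v Pv uv w Pw vw u≢w =
    contradiction (hom Pu Pv (adj⇒≢ G uv)) (true≢false uv)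

  homogeneous-node : ∀ {β p side} → Crosses G β p side →
                     (∀ b → Homogeneous G β (_∈ cut p side b)) → Homogeneous G β (_∈ p)
  homogeneous-node {side = side} crosses hom {u} {v} u∈p v∈p u≢v with side u Bool.≟ side v
  ... | yes eq = hom (side v) (∈-cut⁺ u∈p eq) (∈-cut⁺ v∈p refl) u≢v
  ... | no  ne = crosses u∈p v∈p ne

  same-side : ∀ {p side u v} → Crosses G false p side → u ∈ p → v ∈ p → adj G u v ≡ true →
              side u ≡ side v
  same-side {side = side} {u} {v} crosses u∈p v∈p uv =
    decidable-stable (side u Bool.≟ side v) (true≢false uv ∘ crosses u∈p v∈p)

  cluster-node : ∀ {p side} {P : Pred (Fin (n G)) 0ℓ} → Crosses G false p side →
                 (∀ {u} → P u → u ∈ p) → (∀ b → Cluster G (λ u → P u × side u ≡ b)) → Cluster G P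
  cluster-node {side = side} crosses P⊆p clus u Pu v Pv uv w Pw vw u≢w =
    clus (side v) u (Pu , same-side crosses (P⊆p Pu) (P⊆p Pv) uv) v (Pv , refl) uv
         w (Pw , ≡-sym (same-side crosses (P⊆p Pv) (P⊆p Pw) vw)) vw u≢w

  cluster-⊆ : ∀ {P Q : Pred (Fin (n G)) 0ℓ} → (∀ {u} → Q u → P u) → Cluster G P → Cluster G Q
  cluster-⊆ Q⊆P clus u Qu v Qv uv w Qw = clus u (Q⊆P Qu) v (Q⊆P Qv) uv w (Q⊆P Qw)

  leaf-homogeneous : ∀ {p v} β → (∀ {u} → u ∈ p → u ≡ v) → Homogeneous G β (_∈ p)
  leaf-homogeneous β only u∈p v∈p u≢v = contradiction (trans (only u∈p) (≡-sym (only v∈p))) u≢v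

  -- A node labelled `β` has a `β`-pair across it; if every node carries `not β`, so does every pair
  -- of vertices.
  pair-or-homogeneous : ∀ {p} → Cotree G p → ∀ β →
                        EmbedsIn (pair β) G p ⊎ Homogeneous G (not β) (_∈ p)
  pair-or-homogeneous (leaf v _ only) β = inj₂ (leaf-homogeneous (not β) only)
  pair-or-homogeneous (node γ side crosses child) β with γ Bool.≟ β
  ... | yes refl = inj₁ (embed-glue crosses (b≢not-b true)
                          (embed-K₁ (inhabited (child true))) (embed-K₁ (inhabited (child false))))
  ... | no γ≢β with refl ← Bool.¬-not γ≢β
    with all-or-some (λ b → swap (pair-or-homogeneous (child b) β))
  ... | inj₁ hom     = inj₂ (homogeneous-node crosses hom)
  ... | inj₂ (b , e) = inj₁ (widen e)

  -- A split graph: colour `true` is a clique and colour `false` is independent, both expressed by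
  -- one equation.
  Split : Subset (n G) → Set
  Split p = Σ (Fin (n G) → Bool) λ c →
    ∀ {u v} → u ∈ p → v ∈ p → u ≢ v → c u ≡ c v → adj G u v ≡ c u

  -- A `β`-homogeneous side that is `β`-adjacent to all the rest can be absorbed into colour class
  -- `β`.
  split-node : ∀ {β p side} → Crosses G β p side → ∀ b →
               Homogeneous G β (_∈ cut p side b) → Split (cut p side (not b)) → Split p
  split-node {β} {p} {side} crosses b hom (c , split) = c′ , split′
    where
    c′ : Fin (n G) → Bool
    c′ u = if does (side u Bool.≟ b) then β else c u

    split′ : ∀ {u v} → u ∈ p → v ∈ p → u ≢ v → c′ u ≡ c′ v → adj G u v ≡ c′ u
    split′ {u} {v} u∈p v∈p u≢v eq with side u Bool.≟ b | side v Bool.≟ b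
    ... | yes su | yes sv = hom (∈-cut⁺ u∈p su) (∈-cut⁺ v∈p sv) u≢v
    ... | yes su | no sv  = crosses u∈p v∈p λ e → sv (trans (≡-sym e) su)
    ... | no su  | yes sv = trans (crosses u∈p v∈p λ e → su (trans e sv)) (≡-sym eq)
    ... | no su  | no sv  =
      split (∈-cut⁺ u∈p (Bool.¬-not su)) (∈-cut⁺ v∈p (Bool.¬-not sv)) u≢v eq

  -- Two non-edges across a join span C₄ and two edges across a union span 2K₂, so otherwise some
  -- side has no `not β`-pair.
  quad-or-homogeneous : ∀ {β p side} → Crosses G β p side → (∀ b → Cotree G (cut p side b)) →
    EmbedsIn (quad β) G p ⊎ ∃ λ b → Homogeneous G β (_∈ cut p side b)
  quad-or-homogeneous {β = β} crosses child
    with all-or-some (λ b → pair-or-homogeneous (child b) (not β))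
  ... | inj₁ pairs     = inj₁ (embed-glue crosses (b≢not-b true) (pairs true) (pairs false))
  ... | inj₂ (b , hom) = inj₂ (b , λ u∈ v∈ u≢v → trans (hom u∈ v∈ u≢v) (Bool.not-involutive β))

  -- The Földes-Hammer characterisation of split graphs; C₅ is absent because it contains P₄. At
  -- each node one side is homogeneous and is absorbed by a colour class.
  quad-or-split : ∀ {p} → Cotree G p → (∃ λ β → EmbedsIn (quad β) G p) ⊎ Split p
  quad-or-split (leaf v _ only) =
    inj₂ ((λ _ → true) , λ u∈p v∈p u≢v _ → leaf-homogeneous true only u∈p v∈p u≢v)
  quad-or-split (node β side crosses child) with quad-or-homogeneous crosses child
  ... | inj₁ q = inj₁ (β , q)
  ... | inj₂ (b , hom) with quad-or-split (child (not b))
  ... | inj₁ (γ , q) = inj₁ (γ , widen q)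
  ... | inj₂ split   = inj₂ (split-node crosses b hom split)

  -- A non-edge on one side of a join makes a P₃ with any vertex of the other side; dually, an edge
  -- on one side of a union makes K₁+K₂.
  cherry-or-cluster : ∀ {p} → Cotree G p → EmbedsIn (cherry true) G p ⊎
    Cluster G (_∈ p) × (EmbedsIn (cherry false) G p ⊎ ∃ λ β → Homogeneous G β (_∈ p))
  cherry-or-cluster (leaf v _ only) =
    inj₂ (homogeneous⇒cluster (leaf-homogeneous true only) , inj₂ (true , leaf-homogeneous true only))
  cherry-or-cluster (node true side crosses child)
    with all-or-some (λ b → swap (pair-or-homogeneous (child b) false))
  ... | inj₂ (b , e) = inj₁ (embed-glue crosses (not-b≢b b) (embed-K₁ (inhabited (child (not b)))) e)
  ... | inj₁ hom     = let hom′ = homogeneous-node crosses hom in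
                       inj₂ (homogeneous⇒cluster hom′ , inj₂ (true , hom′))
  cherry-or-cluster {p} (node false side crosses child)
    with all-or-some (λ b → swap (cherry-or-cluster (child b)))
  ... | inj₂ (b , e) = inj₁ (widen e)
  ... | inj₁ sub = inj₂ (cluster-node crosses id (λ b →
    cluster-⊆ (λ (u∈p , su) → ∈-cut⁺ u∈p su) (proj₁ (sub b))) , rest)
    where
    rest : EmbedsIn (cherry false) G p ⊎ ∃ λ β → Homogeneous G β (_∈ p)
    rest with all-or-some (λ b → swap (pair-or-homogeneous (child b) true))
    ... | inj₂ (b , e) = inj₁ (embed-glue crosses (not-b≢b b) (embed-K₁ (inhabited (child (not b)))) e)
    ... | inj₁ hom     = inj₂ (false , homogeneous-node crosses hom)

  -- `K₁⊕H` is (1,∞)-polar exactly when `H` is a cluster (apex in `A`) or split (apex in `B`), so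
  -- these are the outcomes sought for the base of a cone.
  coneBase-or-split-or-cluster : ∀ {p} → Cotree G p →
    (∃ λ i → EmbedsIn (coneBase i) G p) ⊎ Split p ⊎ Cluster G (_∈ p)
  coneBase-or-split-or-cluster (leaf _ _ only) =
    inj₂ (inj₂ (homogeneous⇒cluster (leaf-homogeneous true only)))
  coneBase-or-split-or-cluster (node true side crosses child)
    with all-or-some (λ b → swap (quad-or-split (child b)))
  ... | inj₂ (b , true , q)  = inj₁ (zero , widen q)
  ... | inj₂ (b , false , q) =
    inj₁ (suc zero , embed-glue crosses (not-b≢b b) (embed-K₁ (inhabited (child (not b)))) q)
  ... | inj₁ splits with quad-or-homogeneous crosses child
  ... | inj₁ q         = inj₁ (zero , q)
  ... | inj₂ (b , hom) = inj₂ (inj₁ (split-node crosses b hom (splits (not b))))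
  coneBase-or-split-or-cluster {p} (node false side crosses child)
    with all-or-some (λ b → pair-or-homogeneous (child b) true)
  -- Both sides have an edge, so a P₃ on either of them yields P₃+K₂.
  ... | inj₁ pairs with all-or-some (λ b → swap (cherry-or-cluster (child b)))
  ...   | inj₂ (b , e) = inj₁ (suc (suc zero) , embed-glue crosses (b≢not-b b) e (pairs (not b)))
  ...   | inj₁ sub     = inj₂ (inj₂ (cluster-node crosses id λ b →
    cluster-⊆ (λ (u∈p , su) → ∈-cut⁺ u∈p su) (proj₁ (sub b))))
  -- Side `b` is independent; adding isolated vertices preserves being split and being a cluster.
  coneBase-or-split-or-cluster {p} (node false side crosses child) | inj₂ (b , hom)
    with coneBase-or-split-or-cluster (child (not b))
  ... | inj₁ (i , e)      = inj₁ (i , widen e)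
  ... | inj₂ (inj₁ split) = inj₂ (inj₁ (split-node crosses b hom split))
  ... | inj₂ (inj₂ clus)  = inj₂ (inj₂ (cluster-node crosses id clusters))
    where
    clusters : ∀ c → Cluster G (λ u → u ∈ p × side u ≡ c)
    clusters c with c Bool.≟ b
    ... | yes refl = cluster-⊆ (λ (u∈p , su) → ∈-cut⁺ u∈p su) (homogeneous⇒cluster hom)
    ... | no c≢b with refl ← Bool.¬-not c≢b = cluster-⊆ (λ (u∈p , su) → ∈-cut⁺ u∈p su) clus

  -- (1,∞)-polarity, with the single part expressed as independence of `A`.
  record Monopolar (p : Subset (n G)) : Set where
    field
      inA     : Fin (n G) → Bool
      indep   : ∀ {u v} → u ∈ p → v ∈ p → inA u ≡ true → inA v ≡ true → adj G u v ≡ false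
      cluster : Cluster G (λ u → u ∈ p × inA u ≡ false)

  split⇒monopolar : ∀ {p} → Split p → Monopolar p
  split⇒monopolar {p} (c , split) = record
    { inA     = not ∘ c
    ; indep   = indep
    ; cluster = homogeneous⇒cluster {β = true} λ (u∈p , cu) (v∈p , cv) u≢v →
        trans (split u∈p v∈p u≢v (Bool.not-injective (trans cu (≡-sym cv)))) (Bool.not-injective cu)
    }
    where
    indep : ∀ {u v} → u ∈ p → v ∈ p → not (c u) ≡ true → not (c v) ≡ true → adj G u v ≡ false
    indep {u} {v} u∈p v∈p cu cv with u ≟ v
    ... | yes refl = irrefl G u
    ... | no u≢v   =
      trans (split u∈p v∈p u≢v (Bool.not-injective (trans cu (≡-sym cv)))) (Bool.not-injective cu)

  indep+cluster⇒monopolar : ∀ {p side} b → Homogeneous G false (_∈ cut p side b) →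
                            Cluster G (_∈ cut p side (not b)) → Monopolar p
  indep+cluster⇒monopolar {p} {side} b hom clus = record
    { inA     = λ u → does (side u Bool.≟ b)
    ; indep   = indep
    ; cluster = cluster-⊆ (λ {u} (u∈p , su) → ∈-cut⁺ u∈p (Bool.¬-not λ eq →
        true≢false (dec-true (side u Bool.≟ b) eq) su)) clus
    }
    where
    indep : ∀ {u v} → u ∈ p → v ∈ p → does (side u Bool.≟ b) ≡ true →
            does (side v Bool.≟ b) ≡ true → adj G u v ≡ false
    indep {u} {v} u∈p v∈p su sv with u ≟ v
    ... | yes refl = irrefl G u
    ... | no u≢v   = hom (∈-cut⁺ u∈p (does⁻ (side u Bool.≟ b) su))
                         (∈-cut⁺ v∈p (does⁻ (side v Bool.≟ b) sv)) u≢v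

  -- Independent sets and clusters are closed under disjoint union; complete multipartite graphs
  -- with an edge are not, which is why monopolarity is the notion to use on each side.
  monopolar-node : ∀ {p side} → Crosses G false p side → (∀ b → Monopolar (cut p side b)) →
                   Monopolar p
  monopolar-node {p} {side} crosses sub = record
    { inA     = inA
    ; indep   = indep
    ; cluster = cluster-node crosses proj₁ λ b → cluster-⊆
        (λ { ((u∈p , Bu) , refl) → ∈-cut⁺ u∈p refl , Bu }) (Monopolar.cluster (sub b))
    }
    where
    inA : Fin (n G) → Bool
    inA u = Monopolar.inA (sub (side u)) u

    indep : ∀ {u v} → u ∈ p → v ∈ p → inA u ≡ true → inA v ≡ true → adj G u v ≡ false
    indep {u} {v} u∈p v∈p Au Av with side u Bool.≟ side v
    ... | no ne  = crosses u∈p v∈p ne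
    ... | yes eq = Monopolar.indep (sub (side v)) (∈-cut⁺ u∈p eq) (∈-cut⁺ v∈p refl)
                     (subst (λ b → Monopolar.inA (sub b) u ≡ true) eq Au) Av

  MonopolarOrObstructed : Subset (n G) → Set
  MonopolarOrObstructed p = Monopolar p ⊎ ∃ λ i → EmbedsIn (monoObstruction i) G p

  module _ {p side} (crosses : Crosses G true p side) (child : ∀ b → Cotree G (cut p side b)) where

    -- Over a clique with an edge the other side has to be split; over a single apex it may also be
    -- a cluster.
    monopolar-clique-join : ∀ b → Homogeneous G true (_∈ cut p side b) → MonopolarOrObstructed p
    monopolar-clique-join b clique = go
      where
      apex : EmbedsIn K₁ G (cut p side b)
      apex = embed-K₁ (inhabited (child b))

      go : MonopolarOrObstructed p
      go with pair-or-homogeneous (child b) true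
      go | inj₁ edge with quad-or-split (child (not b))
      ... | inj₁ (true , q)  = inj₂ (# 0 , embed-glue crosses (b≢not-b b) apex q)
      ... | inj₁ (false , q) = inj₂ (# 4 , embed-glue crosses (b≢not-b b) edge q)
      ... | inj₂ split       = inj₁ (split⇒monopolar (split-node crosses b clique split))
      -- Side `b` is now both a clique and independent, that is, one vertex.
      go | inj₂ indep with coneBase-or-split-or-cluster (child (not b))
      ... | inj₁ (zero , e)           = inj₂ (# 0 , embed-glue crosses (b≢not-b b) apex e)
      ... | inj₁ (suc zero , e)       = inj₂ (# 1 , embed-glue crosses (b≢not-b b) apex e)
      ... | inj₁ (suc (suc zero) , e) = inj₂ (# 2 , embed-glue crosses (b≢not-b b) apex e)
      ... | inj₂ (inj₁ split) = inj₁ (split⇒monopolar (split-node crosses b clique split))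
      ... | inj₂ (inj₂ clus)  = inj₁ (indep+cluster⇒monopolar b indep clus)

    -- If neither side is a clique, a P₃ on one side and a non-edge on the other give 2K₁⊕P₃. Sides
    -- without P₃ are clusters, and unless both contain K₁+K₂ one of them is homogeneous.
    monopolar-join : MonopolarOrObstructed p
    monopolar-join with all-or-some (λ b → pair-or-homogeneous (child b) false)
    ... | inj₂ (b , clique) = monopolar-clique-join b clique
    ... | inj₁ pairs with all-or-some (λ b → swap (cherry-or-cluster (child b)))
    ... | inj₂ (b , e) = inj₂ (# 3 , embed-glue crosses (not-b≢b b) (pairs (not b)) e)
    ... | inj₁ sub with all-or-some (λ b → proj₂ (sub b))
    ... | inj₁ es                = inj₂ (# 5 , embed-glue crosses (b≢not-b true) (es true) (es false))
    ... | inj₂ (b , true , hom)  = monopolar-clique-join b hom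
    ... | inj₂ (b , false , hom) = inj₁ (indep+cluster⇒monopolar b hom (proj₁ (sub (not b))))

  monopolar-or-obstructed : ∀ {p} → Cotree G p → MonopolarOrObstructed p
  monopolar-or-obstructed (leaf v _ only) = inj₁ (split⇒monopolar
    ((λ _ → true) , λ u∈p v∈p u≢v _ → leaf-homogeneous true only u∈p v∈p u≢v))
  monopolar-or-obstructed (node true side crosses child) = monopolar-join crosses child
  monopolar-or-obstructed (node false side crosses child)
    with all-or-some (λ b → monopolar-or-obstructed (child b))
  ... | inj₁ sub         = inj₁ (monopolar-node crosses sub)
  ... | inj₂ (b , i , e) = inj₂ (i , widen e)

-- The disconnected polar obstructions

module _ (G : Graph) where

  cluster? : ∀ {P} → Decidable P → Dec (Cluster G P)
  cluster? P? = all? λ u → P? u →-dec all? λ v → P? v →-dec (adj G u v Bool.≟ true) →-dec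
    all? λ w → P? w →-dec (adj G v w Bool.≟ true) →-dec ¬? (u ≟ w) →-dec (adj G u w Bool.≟ true)

  completeMultipartite? : ∀ {P} → Decidable P → Dec (CompleteMultipartite G P)
  completeMultipartite? P? = all? λ u → P? u →-dec all? λ v → P? v →-dec (adj G u v Bool.≟ false) →-dec
    all? λ w → P? w →-dec (adj G v w Bool.≟ false) →-dec (adj G u w Bool.≟ false)

  -- (∞,∞)-polarity with all labels removed, so that it can be decided by searching through the
  -- subsets.
  PolarSet : Subset (n G) → Set
  PolarSet A = Cluster G (λ u → lookup A u ≡ false) × CompleteMultipartite G (λ u → lookup A u ≡ true)

  polarSet? : Decidable PolarSet
  polarSet? A = cluster? (λ u → lookup A u Bool.≟ false) ×-dec
                completeMultipartite? (λ u → lookup A u Bool.≟ true)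

  polarOn⇒polarSet : PolarOn G s Whole → ∃ PolarSet
  polarOn⇒polarSet π = tabulate inA ,
    (λ u Bu v Bv uv w Bw vw u≢w → cluster u (_ , un Bu) v (_ , un Bv) uv w (_ , un Bw) vw u≢w) ,
    λ u Au v Av uv w Aw vw → ≢true⇒false λ uw → multi⇒ _ _ (un Au) (un Aw) uw
      (trans (part-≡ _ _ (un Au) (un Av) uv) (part-≡ _ _ (un Av) (un Aw) vw))
    where
    open PolarOn π

    un : ∀ {u b} → lookup (tabulate inA) u ≡ b → inA u ≡ b
    un {u} = trans (≡-sym (lookup∘tabulate inA u))

  -- The two parts are the neighbours and the non-neighbours of r.
  Bipolar : Pred (Fin (n G)) 0ℓ → (Fin (n G) → Bool) → Set
  Bipolar P inA = Cluster G (λ u → P u × inA u ≡ false) × ∃ λ r →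
    ∀ u → P u × inA u ≡ true → ∀ v → P v × inA v ≡ true → adj G u v ≡ adj G r u xor adj G r v

  bipolar? : ∀ {P} → Decidable P → Decidable (Bipolar P)
  bipolar? P? inA = cluster? (λ u → P? u ×-dec (inA u Bool.≟ false)) ×-dec any? λ r →
    all? λ u → (P? u ×-dec (inA u Bool.≟ true)) →-dec all? λ v → (P? v ×-dec (inA v Bool.≟ true)) →-dec
    (adj G u v Bool.≟ (adj G r u xor adj G r v))

  bipolar⇒polarOn : ∀ {P k} → 2 ≤ k → ∃ (Bipolar P) → PolarOn G (fin k) P
  bipolar⇒polarOn 2≤k (inA , clus , r , bip) = record
    { inA     = inA
    ; part    = label ∘ adj G r
    ; part-ok = λ {u} _ _ → ℕ.<-≤-trans (label<2 (adj G r u)) 2≤k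
    ; multi⇒  = λ {u} {v} Pu Pv Au Av uv →
        xor⇒label≢ (adj G r u) (adj G r v) (trans (≡-sym (bip u (Pu , Au) v (Pv , Av))) uv)
    ; multi⇐  = λ {u} {v} Pu Pv Au Av ne →
        trans (bip u (Pu , Au) v (Pv , Av)) (label≢⇒xor (adj G r u) (adj G r v) ne)
    ; cluster = clus
    }
    where
    label : Bool → ℕ
    label b = if b then 1 else 0

    label<2 : ∀ b → label b < 2
    label<2 true  = s≤s (s≤s z≤n)
    label<2 false = s≤s z≤n

    xor⇒label≢ : ∀ b c → b xor c ≡ true → label b ≢ label c
    xor⇒label≢ true  false _ ()
    xor⇒label≢ false true  _ ()

    label≢⇒xor : ∀ b c → label b ≢ label c → b xor c ≡ true
    label≢⇒xor true  true  ne = contradiction refl ne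
    label≢⇒xor true  false ne = refl
    label≢⇒xor false true  ne = refl
    label≢⇒xor false false ne = contradiction refl ne

-- Opaque, because normalising the exhaustive checks is expensive.
abstract

  -- These graphs have eight or nine vertices, so every subset can be tried as `A`.
  polarObstruction-nonpolar : ∀ i → ¬ PolarOn (polarObstruction i) s Whole
  polarObstruction-nonpolar i = check i ∘ polarOn⇒polarSet (polarObstruction i)
    where
    check : ∀ i → ¬ ∃ (PolarSet (polarObstruction i))
    check = toWitness {a? = all? λ i → ¬? (anySubset? (polarSet? (polarObstruction i)))} _

-- Found by computer search: whichever vertex of polarObstruction i is deleted, one of these
-- sets serves as the multipartite side. Vertices 0, 1, 2 form the P₃, with centre 0.
multipartiteSides : Fin 6 → List (List ℕ)
multipartiteSides zero =
  (5 ∷ 7 ∷ []) ∷ (2 ∷ 7 ∷ []) ∷ (2 ∷ 4 ∷ 5 ∷ []) ∷ []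
multipartiteSides (suc zero) =
  (2 ∷ 7 ∷ 8 ∷ []) ∷ (1 ∷ 5 ∷ 6 ∷ []) ∷ (0 ∷ 3 ∷ 4 ∷ []) ∷ []
multipartiteSides (suc (suc zero)) =
  (3 ∷ 6 ∷ []) ∷ (2 ∷ 6 ∷ []) ∷ (2 ∷ 6 ∷ 7 ∷ 8 ∷ []) ∷ (2 ∷ 3 ∷ []) ∷ []
multipartiteSides (suc (suc (suc zero))) =
  (4 ∷ 7 ∷ []) ∷ (2 ∷ 7 ∷ []) ∷ (2 ∷ 3 ∷ 4 ∷ []) ∷ []
multipartiteSides (suc (suc (suc (suc zero)))) =
  (2 ∷ 7 ∷ 8 ∷ []) ∷ (1 ∷ 5 ∷ 6 ∷ []) ∷ (0 ∷ 3 ∷ 4 ∷ []) ∷ []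
multipartiteSides (suc (suc (suc (suc (suc zero))))) =
  (3 ∷ 6 ∷ []) ∷ (2 ∷ 6 ∷ 7 ∷ 8 ∷ []) ∷ (2 ∷ 3 ∷ 6 ∷ []) ∷ (2 ∷ 3 ∷ 4 ∷ 5 ∷ []) ∷ []

member : ∀ {m} → List ℕ → Fin m → Bool
member xs u = any (toℕ u ≡ᵇ_) xs

abstract

  polarObstruction-deleted : ∀ {k} → 2 ≤ k → ∀ i j → PolarOn (polarObstruction i) (fin k) (_≢ j)
  polarObstruction-deleted 2≤k i j =
    let xs , bip = Any.satisfied (check i j) in bipolar⇒polarOn _ 2≤k (member xs , bip)
    where
    check : ∀ i j → Any (λ xs → Bipolar (polarObstruction i) (_≢ j) (member xs)) (multipartiteSides i)
    check = toWitness {a? = all? λ i → all? λ j →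
      Any.any? (λ xs → bipolar? (polarObstruction i) (λ u → ¬? (u ≟ j)) (member xs)) (multipartiteSides i)} _

-- Separations

monopolar⇒polarOn : Below s 0 → Monopolar G full → PolarOn G s Whole
monopolar⇒polarOn {G = G} ok μ = record
  { inA     = inA
  ; part    = λ _ → 0
  ; part-ok = λ _ _ → ok
  ; multi⇒  = λ _ _ Au Av uv _ → true≢false uv (indep ∈⊤ ∈⊤ Au Av)
  ; multi⇐  = λ _ _ _ _ ne → contradiction refl ne
  ; cluster = cluster-⊆ G (λ (_ , Bu) → ∈⊤ , Bu) cluster
  }
  where open Monopolar μ

-- Two vertices on the same side are linked through any vertex of the other side.
join⇒connected : ∀ {side} → Crosses G true full side → (∀ b → ∃ λ u → side u ≡ b) → Connected G
join⇒connected {G} {side} crosses both u v with side u Bool.≟ side v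
... | no ne  = step (crosses ∈⊤ ∈⊤ ne) here
... | yes eq with w , sw ← both (not (side u)) =
  step (crosses ∈⊤ ∈⊤ λ uw → Bool.not-¬ (≡-sym uw) sw)
    (step (crosses ∈⊤ ∈⊤ λ wv → Bool.not-¬ (trans wv (≡-sym eq)) sw) here)

Separation : Graph → Set
Separation G = Σ (Fin (n G) → Bool) λ side →
  Crosses G false full side × (∀ b → Cotree G (cut full side b))

-- The root of the cotree is a union, because the empty graph, a single vertex and a join are all
-- connected.
separation : Cograph G → Disconnected G → Separation G
separation {G} cograph disconnected
  with nonempty? {n G} full
... | no empty = contradiction (λ u → contradiction (u , ∈⊤) empty) disconnected
... | yes ne with cotree cograph full (⊂-wellFounded full) ne
... | leaf v _ only =
  contradiction (λ u w → subst (Reachable G u) (trans (only ∈⊤) (≡-sym (only ∈⊤))) here) disconnected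
... | node false side crosses child = side , crosses , child
... | node true side crosses child  = contradiction
  (join⇒connected crosses λ b → let u , u∈ = inhabited (child b) in u , proj₂ (∈-cut⁻ u∈)) disconnected

module _ (σ : Separation G) where

  private
    side : Fin (n G) → Bool
    side = proj₁ σ

    crosses : Crosses G false full side
    crosses = proj₁ (proj₂ σ)

    child : ∀ b → Cotree G (cut full side b)
    child = proj₂ (proj₂ σ)

  -- Take a partition of the graph without some vertex `w` of side `b`. It covers the opposite side
  -- entirely, and side `b` can be put into `B` as a whole because no edges leave it.
  attach-cluster : ∀ b → Cluster G (_∈ cut full side b) → (∀ v → PolarOn G s (_≢ v)) → PolarOn G s Whole
  attach-cluster {s} b clus deleted with w , w∈ ← inhabited (child b) = record
    { inA     = inA′
    ; part    = part
    ; part-ok = λ _ Au → part-ok (off Au) (inA′⇒inA Au)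
    ; multi⇒  = λ _ _ Au Av → multi⇒ (off Au) (off Av) (inA′⇒inA Au) (inA′⇒inA Av)
    ; multi⇐  = λ _ _ Au Av → multi⇐ (off Au) (off Av) (inA′⇒inA Au) (inA′⇒inA Av)
    ; cluster = cluster-node G crosses (λ _ → ∈⊤) clusters
    }
    where
    open PolarOn (deleted w)

    inA′ : Fin (n G) → Bool
    inA′ u = not (does (side u Bool.≟ b)) ∧ inA u

    away⇒≢ : ∀ {u} → side u ≢ b → u ≢ w
    away⇒≢ su refl = su (proj₂ (∈-cut⁻ w∈))

    off : ∀ {u} → inA′ u ≡ true → u ≢ w
    off {u} Au with side u Bool.≟ b
    ... | no su = away⇒≢ su

    inA′⇒inA : ∀ {u} → inA′ u ≡ true → inA u ≡ true
    inA′⇒inA {u} Au with side u Bool.≟ b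
    ... | no _ = Au

    inB : ∀ {u} → side u ≢ b → inA′ u ≡ false → inA u ≡ false
    inB {u} su Bu with side u Bool.≟ b
    ... | no _   = Bu
    ... | yes eq = contradiction eq su

    clusters : ∀ c → Cluster G (λ u → (Unit × inA′ u ≡ false) × side u ≡ c)
    clusters c with c Bool.≟ b
    ... | yes refl = cluster-⊆ G (λ (_ , su) → ∈-cut⁺ ∈⊤ su) clus
    ... | no c≢b   = cluster-⊆ G (λ { ((_ , Bu) , refl) → away⇒≢ c≢b , inB c≢b Bu }) cluster

  -- An edge xy of G[A] confines A to its own side, so the other side lies in B.
  polar⇒bounded : Below s 0 → PolarOn G ∞ Whole → (∀ v → PolarOn G s (_≢ v)) → PolarOn G s Whole
  polar⇒bounded ok π deleted
    with any? (λ x → any? λ y → (inA x Bool.≟ true) ×-dec (inA y Bool.≟ true) ×-dec (adj G x y Bool.≟ true))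
    where open PolarOn π
  -- `A` spans no edge, so one part suffices.
  ... | no none = monopolar⇒polarOn ok record
    { inA     = inA
    ; indep   = λ {u} {v} _ _ Au Av → ≢true⇒false λ uv → none (u , v , Au , Av , uv)
    ; cluster = cluster-⊆ G (λ (_ , Bu) → _ , Bu) cluster
    }
    where open PolarOn π
  ... | yes (x , y , Ax , Ay , xy) = attach-cluster (not (side x))
    (cluster-⊆ G (λ u∈ → _ , inB (proj₂ (∈-cut⁻ u∈))) cluster) deleted
    where
    open PolarOn π

    inB : ∀ {u} → side u ≡ not (side x) → inA u ≡ false
    -- A vertex of `A` on the other side is adjacent to neither `x` nor `y`, which would place both
    -- in its own part.
    inB {u} su = ≢true⇒false λ Au → multi⇒ _ _ Ax Ay xy
      (trans (part-≡ _ _ Ax Au (crosses ∈⊤ ∈⊤ λ eq → Bool.not-¬ (≡-sym eq) su))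
             (part-≡ _ _ Au Ay (crosses ∈⊤ ∈⊤ λ eq →
               Bool.not-¬ (trans eq (≡-sym (same-side G crosses ∈⊤ ∈⊤ xy))) su)))

  -- Monopolar partitions of both sides would combine to one of `G`, and a cluster side could be
  -- attached to `B`; both contradict non-polarity.
  polarObstruction-embeds : ¬ PolarOn G ∞ Whole → (∀ v → PolarOn G ∞ (_≢ v)) →
                            ∃ λ i → EmbedsIn (polarObstruction i) G full
  polarObstruction-embeds nonpolar deleted
    with all-or-some (λ b → monopolar-or-obstructed G (child b))
  ... | inj₁ sub = contradiction (monopolar⇒polarOn _ (monopolar-node G crosses sub)) nonpolar
  ... | inj₂ (b , i , e) with cherry-or-cluster G (child (not b))
  ... | inj₁ e′         = i , embed-glue G crosses (not-b≢b b) e′ e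
  ... | inj₂ (clus , _) = contradiction (attach-cluster (not b) clus deleted) nonpolar

-- By minimality the embedding is onto, so G is the obstruction itself.
embedded⇒deleted : ∀ {k} → 2 ≤ k → ∀ i → EmbedsIn (polarObstruction i) G full →
                   (∀ v → PolarOn G ∞ (_≢ v)) → ∀ v → PolarOn G (fin k) (_≢ v)
embedded⇒deleted {G} 2≤k i e deleted v =
  pullback {H = G} {G = polarObstruction i} preimage (λ u≢v → u≢v ∘ preimage-inj) (λ _ _ → preimage-inj)
    (λ {u} {w} _ _ → trans (≡-sym (emb-adj (preimage u) (preimage w)))
                       (cong₂ (adj G) (proj₂ (onto u)) (proj₂ (onto w))))
    (polarObstruction-deleted 2≤k i (preimage v))
  where
  open EmbedsIn e

  onto : ∀ v → ∃ λ j → emb j ≡ v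
  -- If `emb` missed `v`, the obstruction would embed in the polar graph `G` without `v`.
  onto v = decidable-stable (any? λ j → emb j ≟ v) λ miss → polarObstruction-nonpolar i
    (pullback {H = polarObstruction i} {G = G} emb
      (λ {j} _ eq → miss (j , eq)) (λ _ _ → emb-inj) (λ _ _ → emb-adj _ _) (deleted v))

  preimage : Fin (n G) → Fin (n (polarObstruction i))
  preimage = proj₁ ∘ onto

  preimage-inj : ∀ {u w} → preimage u ≡ preimage w → u ≡ w
  preimage-inj {u} {w} eq = trans (≡-sym (proj₂ (onto u))) (trans (cong emb eq) (proj₂ (onto w)))

relax : ∀ {k} {P : Pred (Fin (n G)) 0ℓ} → PolarOn G (fin k) P → PolarOn G ∞ P
relax π = record { PolarOn π ; part-ok = λ _ _ → tt }

theorem4 : (k : ℕ) → 2 ≤ k → (G : Graph) → Disconnected G →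
    (CographMinimalObstruction (fin k) ∞ G → CographMinimalObstruction ∞ ∞ G) ×
    (CographMinimalObstruction ∞ ∞ G → CographMinimalObstruction (fin k) ∞ G)
theorem4 k 2≤k G disconnected = bounded⇒unbounded , unbounded⇒bounded
  where
  bounded⇒unbounded : CographMinimalObstruction (fin k) ∞ G → CographMinimalObstruction ∞ ∞ G
  bounded⇒unbounded (cograph , nonpolar , proper) =
    cograph ,
    (λ π → nonpolar (fromPolarOn (polar⇒bounded (separation cograph disconnected)
      -- `0 < k`, so the label of a single part is allowed.
      (ℕ.<-≤-trans (s≤s z≤n) 2≤k) (toPolarOn π) (proper⇒deleted proper)))) ,
    deleted⇒proper λ v → relax (proper⇒deleted {G = G} proper v)

  unbounded⇒bounded : CographMinimalObstruction ∞ ∞ G → CographMinimalObstruction (fin k) ∞ G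
  unbounded⇒bounded (cograph , nonpolar , proper) =
    cograph ,
    (λ π → nonpolar (fromPolarOn (relax (toPolarOn π)))) ,
    deleted⇒proper (embedded⇒deleted 2≤k i e deleted)
    where
    deleted : ∀ v → PolarOn G ∞ (_≢ v)
    deleted = proper⇒deleted {G = G} proper

    found : ∃ λ i → EmbedsIn (polarObstruction i) G full
    found = polarObstruction-embeds (separation cograph disconnected) (nonpolar ∘ fromPolarOn) deleted

    i = proj₁ found
    e = proj₂ found
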